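{- Let $(W,S)$ be an arbitrary Coxeter system and let $\omega$ be a finite word in the generators $S$. The $\omega$-sorting order on $W_\omega$ is a maximal lattice with respect to the addition of any collection of Bruhat cover relations: if $C$ is any nonempty collection of pairs $(u,w)\in W_\omega\times W_\omega$ such that $w=ut$ for some reflection $t$, $\ell(w)=\ell(u)+1$, and $u\not\leq_\omega w$, then the poset on $W_\omega$ obtained from the $\omega$-sorting order by adding the relations $u\prec w$ for all $(u,w)\in C$ (and taking the transitive closure) is not a lattice.
   Context: $\ell$ denotes the length function of $(W,S)$; the reflections are the elements of $T=\{wsw^{ -1}:w\in W,\ s\in S\}$. Let $\omega=(\omega_1,\dots,\omega_m)$. A subword $\alpha\subseteq\omega$ is identified with its index set $I(\alpha)=\{i_1<\dots<i_k\}\subseteq I(\omega)=\{1,\dots,m\}$, with $\alpha=(\omega_{i_1},\dots,\omega_{i_k})$. For a word $\alpha=(\alpha_1,\dots,\alpha_k)$ write $\langle\alpha\rangle=\alpha_1\cdots\alpha_k\in W$; $\alpha$ is reduced if $k=\ell(\langle\alpha\rangle)$. $W_\omega\subseteq W$ is the set of elements $\langle\alpha\rangle$ for subwords $\alpha\subseteq\omega$. For $A,B\subseteq I(\omega)$, $A\leq_{\mathsf{lex}}B$ means $A=B$ or $\min((A\cup B)\setminus(A\cap B))\in A$. For $u\in W_\omega$, the $\omega$-sorted word $\mathsf{sort}_\omega(u)$ is the subword of $\omega$ whose index set is $\leq_{\mathsf{lex}}$-minimum among index sets of subwords of $\omega$ that are reduced words for $u$. The $\omega$-sorting order on $W_\omega$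 is: $u\leq_\omega w$ iff $I(\mathsf{sort}_\omega(u))\subseteq I(\mathsf{sort}_\omega(w))$. It is a lattice graded by $\ell$. -}

module Defs where

open import Level using (Level; _⊔_) renaming (suc to lsuc)
open import Algebra.Bundles using (Group)
open import Data.Fin using (Fin) renaming (_≤_ to _≤ᶠ_)
open import Data.Fin.Subset using (Subset; inside; outside; _∈_; _⊆_; _∪_; _∩_; _─_)
open import Data.List using (List; []; _∷_; _++_; foldr; length; concat; replicate)
open import Data.Nat using (ℕ; suc; _≤_)
open import Data.Product using (Σ-syntax; ∃-syntax; ∃₂; _×_; proj₁)
open import Data.Sum using (_⊎_)
open import Data.Vec using (Vec; []; _∷_)
open import Function.Base using (_on_)
open import Function.Bundles using (_⇔_)
open import Relation.Binary.Construct.Closure.Equivalence using (EqClosure)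
open import Relation.Binary.Construct.Closure.Transitive using (TransClosure)
import Relation.Binary.Construct.Union as Union
open import Relation.Binary.Core using (Rel)
open import Relation.Binary.PropositionalEquality using (_≡_)
open import Relation.Binary.Lattice using (IsLattice)

private
  variable
    a c ℓ s p : Level

-- The entry 0 stands for m(s,t) = ∞: the relator (s t)^0 is the empty word,
-- so it imposes nothing.
record CoxeterMatrix (S : Set s) : Set s where
  field
    m        : S → S → ℕ
    m-sym    : ∀ x y → m x y ≡ m y x
    m≡1⇔same : ∀ x y → m x y ≡ 1 ⇔ x ≡ y

module _ {S : Set s} (M : CoxeterMatrix S) where
  open CoxeterMatrix M

  relator : S → S → List S
  relator x y = concat (replicate (m x y) (x ∷ y ∷ []))

  data DeletesRelator : Rel (List S) s where
    delete : ∀ u x y v → DeletesRelator (u ++ relator x y ++ v) (u ++ v)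

  -- Equality of words in ⟨ S ∣ (s t)^m(s,t) ⟩.  Words in S suffice, without
  -- formal inverses: the relator of (s,s) is s s, so s is its own inverse.
  Equivalent : Rel (List S) s
  Equivalent = EqClosure DeletesRelator

-- (W,S) with S indexed by a type through ι.  The equality of W is the
-- group's own _≈_.
record CoxeterSystem c ℓ s : Set (lsuc (c ⊔ ℓ ⊔ s)) where
  field
    W      : Group c ℓ
    S      : Set s
    matrix : CoxeterMatrix S

  open Group W public using (Carrier; _≈_; _∙_; ε; _⁻¹)

  field
    ι : S → Carrier

  ⟨_⟩ : List S → Carrier
  ⟨_⟩ = foldr (λ x w → ι x ∙ w) ε

  field
    generates    : ∀ w → ∃[ α ] ⟨ α ⟩ ≈ w
    presentation : ∀ α β → ⟨ α ⟩ ≈ ⟨ β ⟩ ⇔ Equivalent matrix α β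

select : {A : Set a} → ∀ {n} → Vec A n → Subset n → List A
select []       []            = []
select (x ∷ xs) (inside  ∷ I) = x ∷ select xs I
select (x ∷ xs) (outside ∷ I) = select xs I

IsMinimumOf : ∀ {n} → Fin n → Subset n → Set
IsMinimumOf i D = i ∈ D × (∀ j → j ∈ D → i ≤ᶠ j)

infix 4 _≤lex_
_≤lex_ : ∀ {n} → Rel (Subset n) _
A ≤lex B = A ≡ B ⊎ (∃[ i ] IsMinimumOf i ((A ∪ B) ─ (A ∩ B)) × i ∈ A)

module Coxeter (𝒲 : CoxeterSystem c ℓ s) where
  open CoxeterSystem 𝒲

  -- ℓ(w) = k.  The length is given as a functional relation because it cannot
  -- be computed without deciding equality in W.
  HasLength : Carrier → ℕ → Set _
  HasLength w k = (∃[ α ] ⟨ α ⟩ ≈ w × length α ≡ k)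
                × (∀ α → ⟨ α ⟩ ≈ w → k ≤ length α)

  Reduced : List S → Set _
  Reduced α = HasLength ⟨ α ⟩ (length α)

  IsReflection : Carrier → Set _
  IsReflection t = ∃₂ λ w x → t ≈ (w ∙ ι x) ∙ w ⁻¹

  IsBruhatCover : Rel Carrier _
  IsBruhatCover u w = (∃[ t ] IsReflection t × w ≈ u ∙ t)
                    × (∃[ k ] HasLength u k × HasLength w (suc k))

  module Sorting {n} (ω : Vec S n) where

    IsReducedWordFor : Subset n → Carrier → Set _
    IsReducedWordFor I u = Reduced (select ω I) × ⟨ select ω I ⟩ ≈ u

    -- I = I(sort_ω(u)); such an I is unique since _≤lex_ is antisymmetric.
    IsSortIndexSet : Subset n → Carrier → Set _
    IsSortIndexSet I u = IsReducedWordFor I u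
                       × (∀ J → IsReducedWordFor J u → I ≤lex J)

    W_ω : Set _
    W_ω = Σ[ w ∈ Carrier ] ∃[ I ] ⟨ select ω I ⟩ ≈ w

    -- The subword in an element of W_ω only witnesses membership and is
    -- irrelevant to equality.
    infix 4 _≈ω_ _≤ω_
    _≈ω_ : Rel W_ω _
    _≈ω_ = _≈_ on proj₁

    _≤ω_ : Rel W_ω _
    u ≤ω w = ∃₂ λ I J → IsSortIndexSet I (proj₁ u) × IsSortIndexSet J (proj₁ w) × I ⊆ J

    -- Classically _≈ω_ is already contained in _≤ω_.  It is listed separately
    -- because reflexivity of _≤ω_ needs a sorted word to exist, and finding one
    -- requires deciding equality in W.
    Adding : Rel W_ω p → Rel W_ω _
    Adding C = TransClosure (_≈ω_ Union.∪ (_≤ω_ Union.∪ C))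

    LatticeOrder : Rel W_ω p → Set _
    LatticeOrder _≼_ = ∃₂ λ _∨_ _∧_ → IsLattice _≈ω_ _≼_ _∨_ _∧_

{-# OPTIONS --safe #-}

-- Sorted index sets are characterised by a greedy condition: no letter of ω,
-- selected or not, is a left descent of what is selected to its right.  By the
-- strong exchange condition a Bruhat cover u ≺ w, with sorted index sets I and
-- J, either has I ⊆ J or, at the first position i where I and J differ, i ∈ I.
-- In the second case let U be the part of I up to i, and Jₘ the part of J
-- before m.  Both Jₘ and, for m > i, Jₘ ∪ {i} are sorted.  If U ⋠ Jₘ, U ≼ Jₘ₊₁
-- and Jₘ₊₁ ≠ Jₘ, then the join of U and Jₘ would by length have to equal both
-- of its upper bounds Jₘ₊₁ and Jₘ ∪ {i}, which differ; so U ⋠ Jₘ for all m > i,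
-- against U ≤ u ≺ w.
--
-- Equality in W is not decidable, so the exchange condition is derived from
-- parities of truth values instead of parities of numbers, and the
-- classical steps take place under a double negation.
module Submission where

open import Defs
open import Algebra.Bundles using (Group; AbelianGroup)
import Algebra.Properties.CommutativeSemigroup as CommutativeSemigroupProperties
import Algebra.Properties.Group as GroupProperties
import Algebra.Properties.Monoid as MonoidProperties
open import Data.Bool using (Bool; true; false; not; _xor_)
import Data.Bool.Properties as Bool
import Data.Empty as Empty
open import Data.Empty.Polymorphic using (⊥)
open import Data.Fin using (Fin; zero; suc; toℕ)
open import Data.Fin.Subset using (Subset; inside; outside; _∈_; _⊆_; ∣_∣; _∪_; _∩_; _─_) renaming (⊥ to ∅)
open import Data.Fin.Subset.Properties using (drop-∷-⊆; out⊆; s⊆s; p⊆q⇒∣p∣≤∣q∣; ⊥⊆; ⊆-reflexive)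
open import Data.List using (List; []; _∷_; _++_; length; removeAt; concat; replicate)
open import Data.List.Properties using (++-identityʳ; ++-assoc; length-++; length-removeAt′)
open import Data.Nat using (ℕ; zero; suc; _+_; _*_; _≤_; _<_; z≤n; s≤s; s≤s⁻¹)
open import Data.Nat.Properties
  using (≤-refl; ≤-reflexive; ≤-trans; m≤n⇒m≤1+n; ≤-antisym; <-irrefl; <-trans; <-≤-trans; ≤-<-trans; n≮n; _<?_;
         suc-injective; +-cancelʳ-≤; m≤m+n; m≤n+m; +-identityʳ; *-comm)
open import Data.Product using (∃-syntax; ∃₂; _×_; _,_; proj₁; proj₂)
open import Data.Sum using (_⊎_; inj₁; inj₂)
open import Data.Vec using (Vec; []; _∷_; here; there; _[_]≔_)
open import Data.Vec.Properties using (≡-dec)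
open import Function using (_∘_; id; Equivalence)
open import Level using (Level; _⊔_) renaming (suc to lsuc)
open import Relation.Binary.Core using (Rel)
import Relation.Binary.Construct.Closure.Equivalence as EqClosure
import Relation.Binary.Construct.Closure.Transitive as Trans
open import Relation.Binary.Lattice using (IsLattice)
open import Relation.Binary.PropositionalEquality as ≡ using (_≡_; _≢_; cong; subst)
import Relation.Binary.Reasoning.Setoid as SetoidReasoning
open import Relation.Binary.Structures using (IsEquivalence; IsPartialOrder)
open import Relation.Nullary using (¬_; yes; no; contradiction; _because_)
open import Relation.Nullary.Decidable using (decidable-stable; ¬¬-excluded-middle)
open import Relation.Nullary.Negation using (¬¬-map)
open import Relation.Nullary.Reflects using (Reflects; ofʸ; ofⁿ; det; ⊥-reflects)

private
  variable
    a : Level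
    A A′ B B′ : Set a

-- Propositions modulo parity

infixr 3 _⊻_
infix  2 _≃_

_⊻_ : Set a → Set a → Set a
A ⊻ B = A × ¬ B ⊎ ¬ A × B

⊻-reflects : ∀ {x y} → Reflects A x → Reflects B y → Reflects (A ⊻ B) (x xor y)
⊻-reflects (ofʸ p)  (ofʸ q)  = ofⁿ λ { (inj₁ (_ , ¬q)) → ¬q q ; (inj₂ (¬p , _)) → ¬p p }
⊻-reflects (ofʸ p)  (ofⁿ ¬q) = ofʸ (inj₁ (p , ¬q))
⊻-reflects (ofⁿ ¬p) (ofʸ q)  = ofʸ (inj₂ (¬p , q))
⊻-reflects (ofⁿ ¬p) (ofⁿ ¬q) = ofⁿ λ { (inj₁ (p , _)) → ¬p p ; (inj₂ (_ , q)) → ¬q q }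

-- Equal truth values, whenever both are known.  Since equality of booleans is
-- stable, classical case distinctions are available in proofs of _≃_.
_≃_ : Set a → Set a → Set a
A ≃ B = ∀ x y → Reflects A x → Reflects B y → x ≡ y

decide : ∀ (A : Set a) {x y : Bool} → (∀ z → Reflects A z → x ≡ y) → x ≡ y
decide A {x} {y} f = decidable-stable (x Bool.≟ y)
  λ x≢y → ¬¬-excluded-middle {A = A} λ { (z because r) → x≢y (f z r) }

⇔⇒≃ : (A → B) → (B → A) → A ≃ B
⇔⇒≃ f g _ _ (ofʸ p)  r = det (ofʸ (f p)) r
⇔⇒≃ f g _ _ (ofⁿ ¬p) r = det (ofⁿ (¬p ∘ g)) r

≃⇒¬¬ : A ≃ B → A → ¬ ¬ B
≃⇒¬¬ A≃B p ¬q with () ← A≃B true false (ofʸ p) (ofⁿ ¬q)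

≃-isEquivalence : IsEquivalence (_≃_ {a})
≃-isEquivalence = record
  { refl  = λ _ _ → det
  ; sym   = λ A≃B x y r q → ≡.sym (A≃B y x q r)
  ; trans = λ {_} {B} A≃B B≃C x z r q →
      -- The middle proposition comes without a truth value, so one has to be supposed first.
      decide B λ y t → ≡.trans (A≃B x y r t) (B≃C y z t q)
  }

⊻-cong : A ≃ A′ → B ≃ B′ → A ⊻ B ≃ A′ ⊻ B′
⊻-cong {A = A} {A′} {B} {B′} A≃A′ B≃B′ u v r q =
  decide A λ x rx → decide A′ λ x′ rx′ → decide B λ y ry → decide B′ λ y′ ry′ →
  ≡.trans (det r (⊻-reflects rx ry))
    (≡.trans (≡.cong₂ _xor_ (A≃A′ x x′ rx rx′) (B≃B′ y y′ ry ry′))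
             (det (⊻-reflects rx′ ry′) q))

⊻-assoc : (A B C : Set a) → (A ⊻ B) ⊻ C ≃ A ⊻ (B ⊻ C)
⊻-assoc A B C u v r q =
  decide A λ x rx → decide B λ y ry → decide C λ z rz →
  ≡.trans (det r (⊻-reflects (⊻-reflects rx ry) rz))
    (≡.trans (Bool.xor-assoc x y z)
             (det (⊻-reflects rx (⊻-reflects ry rz)) q))

⊻-comm : (A B : Set a) → A ⊻ B ≃ B ⊻ A
⊻-comm A B u v r q = decide A λ x rx → decide B λ y ry →
  ≡.trans (det r (⊻-reflects rx ry))
    (≡.trans (Bool.xor-comm x y) (det (⊻-reflects ry rx) q))

⊻-identityˡ : (A : Set a) → ⊥ ⊻ A ≃ A
⊻-identityˡ A u v r q = det r (⊻-reflects ⊥-reflects q)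

⊻-same : (A : Set a) → A ⊻ A ≃ ⊥
⊻-same A u v r q = decide A λ x rx →
  ≡.trans (det r (⊻-reflects rx rx)) (≡.trans (Bool.xor-same x) (det ⊥-reflects q))

parity : ∀ a → AbelianGroup (lsuc a) a
parity a = record
  { Carrier = Set a
  ; _≈_     = _≃_
  ; _∙_     = _⊻_
  ; ε       = ⊥
  ; _⁻¹     = id
  ; isAbelianGroup = record
    { isGroup = record
      { isMonoid = record
        { isSemigroup = record
          { isMagma = record
            { isEquivalence = ≃-isEquivalence
            ; ∙-cong        = ⊻-cong
            }
          ; assoc = ⊻-assoc
          }
        ; identity = ⊻-identityˡ
                   , λ A → E.trans (⊻-comm A ⊥) (⊻-identityˡ A)
        }
      ; inverse = ⊻-same , ⊻-same
      ; ⁻¹-cong = id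
      }
    ; comm = ⊻-comm
    }
  }
  where module E = IsEquivalence ≃-isEquivalence

module Parity {a : Level} where
  open AbelianGroup (parity a) public
  open CommutativeSemigroupProperties commutativeSemigroup public using (x∙yz≈y∙xz)

module Σ⊻ {a : Level} where
  open Parity {a}
  open SetoidReasoning setoid

  -- True when P i holds for an odd number of i < n.
  Σ< : ℕ → (ℕ → Set a) → Set a
  Σ< zero    P = ⊥
  Σ< (suc n) P = P 0 ⊻ Σ< n (P ∘ suc)

  Σ<-cong : ∀ n {P Q} → (∀ i → P i ≃ Q i) → Σ< n P ≃ Σ< n Q
  Σ<-cong zero    P≃Q = refl
  Σ<-cong (suc n) P≃Q = ⊻-cong (P≃Q 0) (Σ<-cong n (P≃Q ∘ suc))

  Σ<-+ : ∀ m n P → Σ< (m + n) P ≃ Σ< m P ⊻ Σ< n (P ∘ (m +_))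
  Σ<-+ zero    n P = sym (identityˡ _)
  Σ<-+ (suc m) n P = trans (∙-congˡ (Σ<-+ m n (P ∘ suc))) (sym (assoc _ _ _))

  -- The range consists of two full periods, and equal parities cancel.
  Σ<-periodic : ∀ m P → (∀ i → P (m + i) ≃ P i) → Σ< (m * 2) P ≃ ⊥
  Σ<-periodic m P per = begin
    Σ< (m * 2) P                    ≡⟨ cong (λ k → Σ< k P) m*2≡m+m ⟩
    Σ< (m + m) P                    ≈⟨ Σ<-+ m m P ⟩
    Σ< m P ⊻ Σ< m (P ∘ (m +_))      ≈⟨ ∙-congˡ (Σ<-cong m per) ⟩
    Σ< m P ⊻ Σ< m P                 ≈⟨ ⊻-same _ ⟩
    ⊥                               ∎
    where
    m*2≡m+m : m * 2 ≡ m + m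
    m*2≡m+m = ≡.trans (*-comm m 2) (cong (m +_) (+-identityʳ m))

-- Words in a Coxeter system

module Words {c ℓ s : Level} (𝒲 : CoxeterSystem c ℓ s) where
  open CoxeterSystem 𝒲
  open Coxeter 𝒲
  open Group W using (refl; sym; trans; assoc; ∙-cong; ∙-congˡ; ∙-congʳ; identityˡ; identityʳ;
                            inverseˡ; inverseʳ; setoid; monoid)
  open GroupProperties W using (∙-cancelˡ; inverseʳ-unique; ⁻¹-anti-homo-∙)
  open MonoidProperties monoid using (cancelˡ)
  open SetoidReasoning setoid

  private
    variable
      x y : S
      t t′ u w : Carrier
      α β : List S

  ⟨⟩-++ : ∀ α β → ⟨ α ++ β ⟩ ≈ ⟨ α ⟩ ∙ ⟨ β ⟩
  ⟨⟩-++ []      β = sym (identityˡ _)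
  ⟨⟩-++ (x ∷ α) β = trans (∙-congˡ (⟨⟩-++ α β)) (sym (assoc _ _ _))

  ⟨relator⟩≈ε : ∀ x y → ⟨ relator matrix x y ⟩ ≈ ε
  ⟨relator⟩≈ε x y = Equivalence.from (presentation (relator matrix x y) [])
    (EqClosure.return (subst (λ r → DeletesRelator matrix r []) (++-identityʳ _) (delete [] x y [])))

  ι-involutive : ∀ x → ι x ∙ ι x ≈ ε
  ι-involutive x = begin
    ι x ∙ ι x                   ≈⟨ ∙-congˡ (identityʳ _) ⟨
    ⟨ x ∷ x ∷ [] ⟩              ≡⟨ cong (λ k → ⟨ concat (replicate k (x ∷ x ∷ [])) ⟩) m≡1 ⟨
    ⟨ relator matrix x x ⟩      ≈⟨ ⟨relator⟩≈ε x x ⟩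
    ε                           ∎
    where
    open CoxeterMatrix matrix
    m≡1 : m x x ≡ 1
    m≡1 = Equivalence.from (m≡1⇔same x x) ≡.refl

  ι-cancel : ∀ x w → ι x ∙ (ι x ∙ w) ≈ w
  ι-cancel x = cancelˡ (ι-involutive x)

  ι-transpose : ι x ∙ u ≈ w → u ≈ ι x ∙ w
  ι-transpose {x} {u} e = trans (sym (ι-cancel x u)) (∙-congˡ e)

  conj : S → Carrier → Carrier
  conj x t = ι x ∙ (t ∙ ι x)

  conj-cong : t ≈ t′ → conj x t ≈ conj x t′
  conj-cong e = ∙-congˡ (∙-congʳ e)

  conj-involutive : ∀ x t → conj x (conj x t) ≈ t
  conj-involutive x t = begin
    ι x ∙ ((ι x ∙ (t ∙ ι x)) ∙ ι x)  ≈⟨ ∙-congˡ (assoc _ _ _) ⟩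
    ι x ∙ (ι x ∙ ((t ∙ ι x) ∙ ι x))  ≈⟨ ι-cancel x _ ⟩
    (t ∙ ι x) ∙ ι x                  ≈⟨ assoc _ _ _ ⟩
    t ∙ (ι x ∙ ι x)                  ≈⟨ ∙-congˡ (ι-involutive x) ⟩
    t ∙ ε                            ≈⟨ identityʳ t ⟩
    t                                ∎

  conj-ι : ∀ x → conj x (ι x) ≈ ι x
  conj-ι x = ι-cancel x (ι x)

  conj-transpose : conj x t ≈ t′ → t ≈ conj x t′
  conj-transpose {x} {t} e = trans (sym (conj-involutive x t)) (conj-cong e)

  conj-untranspose : t ≈ conj x t′ → conj x t ≈ t′
  conj-untranspose e = sym (conj-transpose (sym e))

  conj-shift : ∀ x t w → ι x ∙ (conj x t ∙ w) ≈ t ∙ (ι x ∙ w)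
  conj-shift x t w = begin
    ι x ∙ (conj x t ∙ w)  ≈⟨ assoc _ _ _ ⟨
    (ι x ∙ conj x t) ∙ w  ≈⟨ ∙-congʳ (ι-cancel x _) ⟩
    (t ∙ ι x) ∙ w         ≈⟨ assoc _ _ _ ⟩
    t ∙ (ι x ∙ w)         ∎

  -- This is ⟨ α ⟩⁻¹ t ⟨ α ⟩, computed without inverses and in the order in which `Odd` conjugates.
  conjs : List S → Carrier → Carrier
  conjs []      t = t
  conjs (x ∷ α) t = conjs α (conj x t)

  conjs-shift : ∀ α t → ⟨ α ⟩ ∙ conjs α t ≈ t ∙ ⟨ α ⟩
  conjs-shift []      t = trans (identityˡ t) (sym (identityʳ t))
  conjs-shift (x ∷ α) t = begin
    (ι x ∙ ⟨ α ⟩) ∙ conjs α (conj x t)  ≈⟨ assoc _ _ _ ⟩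
    ι x ∙ (⟨ α ⟩ ∙ conjs α (conj x t))  ≈⟨ ∙-congˡ (conjs-shift α _) ⟩
    ι x ∙ (conj x t ∙ ⟨ α ⟩)            ≈⟨ conj-shift x t _ ⟩
    t ∙ (ι x ∙ ⟨ α ⟩)                   ∎

  conjs-unique : ∀ α {t r} → t ∙ ⟨ α ⟩ ≈ ⟨ α ⟩ ∙ r → conjs α t ≈ r
  conjs-unique α e = ∙-cancelˡ _ _ _ (trans (conjs-shift α _) e)

  -- The word α = s₁ ⋯ sₖ passes the reflections s₁ ⋯ sᵢ ⋯ s₁; Odd α t says that
  -- t occurs among them an odd number of times.
  Odd : List S → Carrier → Set ℓ
  Odd []      t = ⊥
  Odd (x ∷ α) t = t ≈ ι x ⊻ Odd α (conj x t)

  module _ where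
    open Parity {ℓ} renaming
      (refl to ≃-refl; sym to ≃-sym; trans to ≃-trans; identityˡ to ⊻-idˡ; setoid to ≃-setoid; ∙-congˡ to ⊻-congˡ)
      using (x∙yz≈y∙xz)
    open Σ⊻ {ℓ}
    module ≃-Reasoning = SetoidReasoning ≃-setoid

    Odd-cong : ∀ α → t ≈ t′ → Odd α t ≃ Odd α t′
    Odd-cong []      e = ≃-refl
    Odd-cong (x ∷ α) e = ⊻-cong (⇔⇒≃ (trans (sym e)) (trans e)) (Odd-cong α (conj-cong e))

    -- The cocycle identity: the letters of β meet t only after it has been conjugated by ⟨ α ⟩.
    Odd-++ : ∀ α β t → Odd (α ++ β) t ≃ Odd α t ⊻ Odd β (conjs α t)
    Odd-++ []      β t = ≃-sym (⊻-idˡ _)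
    Odd-++ (x ∷ α) β t = ≃-trans (⊻-congˡ (Odd-++ α β (conj x t))) (≃-sym (⊻-assoc _ _ _))

    module _ (x y : S) where
      alternating : ℕ → List S
      alternating k = concat (replicate k (x ∷ y ∷ []))

      -- This is (xy)^i x, the reflection passed by letter number i, counted from 0, of the word x y
      -- x y ⋯.
      dihedral : ℕ → Carrier
      dihedral zero    = ι x
      dihedral (suc i) = ι x ∙ (ι y ∙ dihedral i)

      dihedral-shift : ∀ i → (dihedral i ∙ ι y) ∙ ι x ≈ dihedral (suc i)
      dihedral-shift zero    = assoc _ _ _
      dihedral-shift (suc i) = begin
        ((ι x ∙ (ι y ∙ dihedral i)) ∙ ι y) ∙ ι x  ≈⟨ ∙-congʳ (assoc _ _ _) ⟩
        (ι x ∙ ((ι y ∙ dihedral i) ∙ ι y)) ∙ ι x  ≈⟨ assoc _ _ _ ⟩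
        ι x ∙ (((ι y ∙ dihedral i) ∙ ι y) ∙ ι x)  ≈⟨ ∙-congˡ (∙-congʳ (assoc _ _ _)) ⟩
        ι x ∙ ((ι y ∙ (dihedral i ∙ ι y)) ∙ ι x)  ≈⟨ ∙-congˡ (assoc _ _ _) ⟩
        ι x ∙ (ι y ∙ ((dihedral i ∙ ι y) ∙ ι x))  ≈⟨ ∙-congˡ (∙-congˡ (dihedral-shift i)) ⟩
        dihedral (suc (suc i))                    ∎

      conj-conj-dihedral : ∀ i → conj x (conj y (dihedral i)) ≈ dihedral (suc (suc i))
      conj-conj-dihedral i = begin
        ι x ∙ ((ι y ∙ (dihedral i ∙ ι y)) ∙ ι x)  ≈⟨ ∙-congˡ (assoc _ _ _) ⟩
        ι x ∙ (ι y ∙ ((dihedral i ∙ ι y) ∙ ι x))  ≈⟨ ∙-congˡ (∙-congˡ (dihedral-shift i)) ⟩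
        dihedral (suc (suc i))                    ∎

      dihedral-+ : ∀ k i → dihedral (k + i) ≈ ⟨ alternating k ⟩ ∙ dihedral i
      dihedral-+ zero    i = sym (identityˡ _)
      dihedral-+ (suc k) i = begin
        ι x ∙ (ι y ∙ dihedral (k + i))                   ≈⟨ ∙-congˡ (∙-congˡ (dihedral-+ k i)) ⟩
        ι x ∙ (ι y ∙ (⟨ alternating k ⟩ ∙ dihedral i))   ≈⟨ ∙-congˡ (assoc _ _ _) ⟨
        ι x ∙ ((ι y ∙ ⟨ alternating k ⟩) ∙ dihedral i)   ≈⟨ assoc _ _ _ ⟨
        (ι x ∙ (ι y ∙ ⟨ alternating k ⟩)) ∙ dihedral i   ∎

      -- Two letters are peeled off at a time: they account for the first two reflections, and
      -- conjugation by xy shifts the index of the others by two.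
      Odd-alternating : ∀ k t → Odd (alternating k) t ≃ Σ< (k * 2) (λ i → t ≈ dihedral i)
      Odd-alternating zero    t = ≃-refl
      Odd-alternating (suc k) t =
        ⊻-congˡ (⊻-cong
          (⇔⇒≃ conj-transpose conj-untranspose)
          (≃-trans (Odd-alternating k (conj y (conj x t))) (Σ<-cong (k * 2) λ i →
            ⇔⇒≃ (λ e → trans (conj-transpose (conj-transpose e)) (conj-conj-dihedral i))
                (λ e → conj-untranspose (conj-untranspose (trans e (sym (conj-conj-dihedral i))))))))

    -- With m = m(x,y), the relation (xy)^m = ε gives the reflections of the 2m letters period m, so
    -- each occurs an even number of times. If m(x,y) = ∞, stored as 0, the relator is empty.
    Odd-relator : ∀ x y t → Odd (relator matrix x y) t ≃ ⊥
    Odd-relator x y t = ≃-trans (Odd-alternating x y m t)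
      (Σ<-periodic m _ λ i → ⇔⇒≃ (λ e → trans e (periodic i)) (λ e → trans e (sym (periodic i))))
      where
      m = CoxeterMatrix.m matrix x y
      periodic : ∀ i → dihedral x y (m + i) ≈ dihedral x y i
      periodic i = trans (dihedral-+ x y m i) (trans (∙-congʳ (⟨relator⟩≈ε x y)) (identityˡ _))

    -- The relator itself contributes an even count, and conjugation by it is trivial, so the
    -- letters after it see the same reflection with or without it.
    Odd-delete : DeletesRelator matrix α β → ∀ t → Odd α t ≃ Odd β t
    Odd-delete (delete u x y v) t = R.begin
      Odd (u ++ r ++ v) t                               R.≈⟨ Odd-++ u (r ++ v) t ⟩
      (Odd u t ⊻ Odd (r ++ v) tᵤ)                       R.≈⟨ ⊻-congˡ (Odd-++ r v tᵤ) ⟩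
      (Odd u t ⊻ (Odd r tᵤ ⊻ Odd v (conjs r tᵤ)))       R.≈⟨ ⊻-congˡ (⊻-cong (Odd-relator x y tᵤ) (Odd-cong v fixed)) ⟩
      (Odd u t ⊻ (⊥ ⊻ Odd v tᵤ))                        R.≈⟨ ⊻-congˡ (⊻-idˡ _) ⟩
      (Odd u t ⊻ Odd v tᵤ)                              R.≈⟨ Odd-++ u v t ⟨
      Odd (u ++ v) t                                    R.∎
      where
      module R = ≃-Reasoning
      r = relator matrix x y
      tᵤ = conjs u t
      fixed : conjs r tᵤ ≈ tᵤ
      fixed = conjs-unique r (trans (∙-congˡ (⟨relator⟩≈ε x y))
        (trans (trans (identityʳ _) (sym (identityˡ _))) (sym (∙-congʳ (⟨relator⟩≈ε x y)))))

    -- Deletions of relators generate the equality of W, so the parity is an invariant of the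
    -- element and not only of the word.
    Odd-resp : ⟨ α ⟩ ≈ ⟨ β ⟩ → ∀ t → Odd α t ≃ Odd β t
    Odd-resp e = EqClosure.fold
      {S = λ α β → ∀ t → Odd α t ≃ Odd β t}
      (record { refl  = λ _ → ≃-refl
              ; sym   = λ p t → ≃-sym (p t)
              ; trans = λ p q t → ≃-trans (p t) (q t) })
      Odd-delete (Equivalence.to (presentation _ _) e)

    -- Writing t = w x w⁻¹ and α = γ δ with ⟨ γ ⟩ = w, the word γ x δ represents
    -- t ⟨ α ⟩, and passes t once more than α does.
    Odd-reflection : IsReflection t → ⟨ β ⟩ ≈ t ∙ ⟨ α ⟩ → ¬ Odd α t → ¬ ¬ Odd β t
    Odd-reflection {t} {β} {α} (w , x , t≈wxw⁻¹) β≈tα ¬odd =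
      ≃⇒¬¬ {A = ι x ≈ ι x ⊻ Odd α t} (≃-sym odd-β) (inj₁ (refl , ¬odd))
      where
      γ = proj₁ (generates w)
      δ = proj₁ (generates (w ⁻¹ ∙ ⟨ α ⟩))
      ⟨γ⟩≈w = proj₂ (generates w)

      tγ≈γx : t ∙ ⟨ γ ⟩ ≈ ⟨ γ ⟩ ∙ ι x
      tγ≈γx = begin
        t ∙ ⟨ γ ⟩                    ≈⟨ ∙-cong t≈wxw⁻¹ ⟨γ⟩≈w ⟩
        ((w ∙ ι x) ∙ w ⁻¹) ∙ w       ≈⟨ assoc _ _ _ ⟩
        (w ∙ ι x) ∙ (w ⁻¹ ∙ w)       ≈⟨ ∙-congˡ (inverseˡ w) ⟩
        (w ∙ ι x) ∙ ε                ≈⟨ identityʳ _ ⟩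
        w ∙ ι x                      ≈⟨ ∙-congʳ ⟨γ⟩≈w ⟨
        ⟨ γ ⟩ ∙ ι x                  ∎

      γδ≈α : ⟨ γ ++ δ ⟩ ≈ ⟨ α ⟩
      γδ≈α = begin
        ⟨ γ ++ δ ⟩               ≈⟨ ⟨⟩-++ γ δ ⟩
        ⟨ γ ⟩ ∙ ⟨ δ ⟩            ≈⟨ ∙-cong ⟨γ⟩≈w (proj₂ (generates (w ⁻¹ ∙ ⟨ α ⟩))) ⟩
        w ∙ (w ⁻¹ ∙ ⟨ α ⟩)       ≈⟨ cancelˡ (inverseʳ w) _ ⟩
        ⟨ α ⟩                    ∎

      γxδ≈β : ⟨ γ ++ x ∷ δ ⟩ ≈ ⟨ β ⟩
      γxδ≈β = begin
        ⟨ γ ++ x ∷ δ ⟩           ≈⟨ ⟨⟩-++ γ (x ∷ δ) ⟩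
        ⟨ γ ⟩ ∙ (ι x ∙ ⟨ δ ⟩)    ≈⟨ assoc _ _ _ ⟨
        (⟨ γ ⟩ ∙ ι x) ∙ ⟨ δ ⟩    ≈⟨ ∙-congʳ tγ≈γx ⟨
        (t ∙ ⟨ γ ⟩) ∙ ⟨ δ ⟩      ≈⟨ assoc _ _ _ ⟩
        t ∙ (⟨ γ ⟩ ∙ ⟨ δ ⟩)      ≈⟨ ∙-congˡ (⟨⟩-++ γ δ) ⟨
        t ∙ ⟨ γ ++ δ ⟩           ≈⟨ ∙-congˡ γδ≈α ⟩
        t ∙ ⟨ α ⟩                ≈⟨ β≈tα ⟨
        ⟨ β ⟩                    ∎

      conjs-γ : conjs γ t ≈ ι x
      conjs-γ = conjs-unique γ tγ≈γx

      x≈conjs : conj x (ι x) ≈ conjs γ t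
      x≈conjs = trans (conj-ι x) (sym conjs-γ)

      module R = ≃-Reasoning

      odd-β : Odd β t ≃ ι x ≈ ι x ⊻ Odd α t
      odd-β = R.begin
        Odd β t                                                    R.≈⟨ Odd-resp γxδ≈β t ⟨
        Odd (γ ++ x ∷ δ) t                                         R.≈⟨ Odd-++ γ (x ∷ δ) t ⟩
        (Odd γ t ⊻ Odd (x ∷ δ) (conjs γ t))                        R.≈⟨ ⊻-congˡ (Odd-cong (x ∷ δ) conjs-γ) ⟩
        (Odd γ t ⊻ (ι x ≈ ι x ⊻ Odd δ (conj x (ι x))))             R.≈⟨ ⊻-congˡ (⊻-congˡ (Odd-cong δ x≈conjs)) ⟩
        (Odd γ t ⊻ (ι x ≈ ι x ⊻ Odd δ (conjs γ t)))                R.≈⟨ x∙yz≈y∙xz _ _ _ ⟩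
        (ι x ≈ ι x ⊻ (Odd γ t ⊻ Odd δ (conjs γ t)))                R.≈⟨ ⊻-congˡ (Odd-++ γ δ t) ⟨
        (ι x ≈ ι x ⊻ Odd (γ ++ δ) t)                               R.≈⟨ ⊻-congˡ (Odd-resp γδ≈α t) ⟩
        (ι x ≈ ι x ⊻ Odd α t)                                      R.∎

  -- The strong exchange condition. An odd count is not zero, so some letter passes t, and
  -- multiplication by t from the left cancels that letter.
  Odd⇒removeAt : ∀ α {t} → Odd α t → ∃[ i ] ⟨ removeAt α i ⟩ ≈ t ∙ ⟨ α ⟩
  Odd⇒removeAt (x ∷ α) {t} (inj₁ (t≈x , _)) = zero , sym (trans (∙-congʳ t≈x) (ι-cancel x _))
  Odd⇒removeAt (x ∷ α) {t} (inj₂ (_ , odd)) with i , e ← Odd⇒removeAt α odd =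
    suc i , trans (∙-congˡ e) (conj-shift x t _)

  Odd⇒shorter : ∀ α {t} → Odd α t → ∃[ β ] ⟨ β ⟩ ≈ t ∙ ⟨ α ⟩ × length β < length α
  Odd⇒shorter α odd with i , e ← Odd⇒removeAt α odd =
    removeAt α i , e , ≤-reflexive (≡.sym (length-removeAt′ α i))

  isReflection-ι : ∀ x → IsReflection (ι x)
  isReflection-ι x = ι x , x , sym (trans (∙-congʳ (ι-involutive x))
    (trans (identityˡ _) (sym (inverseʳ-unique _ _ (ι-involutive x)))))

  isReflection-conj : ∀ x → IsReflection t → IsReflection (conj x t)
  isReflection-conj {t} x (w , y , t≈) = ι x ∙ w , y , (begin
    ι x ∙ (t ∙ ι x)                               ≈⟨ ∙-congˡ (∙-congʳ t≈) ⟩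
    ι x ∙ (((w ∙ ι y) ∙ w ⁻¹) ∙ ι x)              ≈⟨ ∙-congˡ (assoc _ _ _) ⟩
    ι x ∙ ((w ∙ ι y) ∙ (w ⁻¹ ∙ ι x))              ≈⟨ assoc _ _ _ ⟨
    (ι x ∙ (w ∙ ι y)) ∙ (w ⁻¹ ∙ ι x)              ≈⟨ ∙-cong (assoc _ _ _) inv ⟨
    ((ι x ∙ w) ∙ ι y) ∙ (ι x ∙ w) ⁻¹              ∎)
    where
    inv : (ι x ∙ w) ⁻¹ ≈ w ⁻¹ ∙ ι x
    inv = trans (⁻¹-anti-homo-∙ (ι x) w) (∙-congˡ (sym (inverseʳ-unique _ _ (ι-involutive x))))

  reflection-involutive : IsReflection t → t ∙ t ≈ ε
  reflection-involutive {t} (w , y , t≈) = begin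
    t ∙ t                                          ≈⟨ ∙-cong t≈ t≈ ⟩
    ((w ∙ ι y) ∙ w ⁻¹) ∙ ((w ∙ ι y) ∙ w ⁻¹)        ≈⟨ assoc _ _ _ ⟩
    (w ∙ ι y) ∙ (w ⁻¹ ∙ ((w ∙ ι y) ∙ w ⁻¹))        ≈⟨ ∙-congˡ (∙-congˡ (assoc _ _ _)) ⟩
    (w ∙ ι y) ∙ (w ⁻¹ ∙ (w ∙ (ι y ∙ w ⁻¹)))        ≈⟨ ∙-congˡ (cancelˡ (inverseˡ w) _) ⟩
    (w ∙ ι y) ∙ (ι y ∙ w ⁻¹)                       ≈⟨ assoc _ _ _ ⟩
    w ∙ (ι y ∙ (ι y ∙ w ⁻¹))                       ≈⟨ ∙-congˡ (ι-cancel y _) ⟩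
    w ∙ w ⁻¹                                       ≈⟨ inverseʳ w ⟩
    ε                                              ∎

  reflection-transpose : IsReflection t → w ≈ t ∙ u → u ≈ t ∙ w
  reflection-transpose ref-t e = sym (trans (∙-congˡ e) (cancelˡ (reflection-involutive ref-t) _))

  -- A Bruhat cover multiplies on the right, whereas `Odd` tests reflections acting from the left; u
  -- t u⁻¹ translates between the two.
  reflectionˡ : IsReflection t → w ≈ u ∙ t → ∃[ r ] IsReflection r × w ≈ r ∙ u
  reflectionˡ {t} {w} {u} (v , y , t≈) w≈ut = (u ∙ t) ∙ u ⁻¹ , (u ∙ v , y , utu⁻¹) , sym (begin
    ((u ∙ t) ∙ u ⁻¹) ∙ u   ≈⟨ assoc _ _ _ ⟩
    (u ∙ t) ∙ (u ⁻¹ ∙ u)   ≈⟨ ∙-congˡ (inverseˡ u) ⟩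
    (u ∙ t) ∙ ε            ≈⟨ identityʳ _ ⟩
    u ∙ t                  ≈⟨ w≈ut ⟨
    w                      ∎)
    where
    utu⁻¹ : (u ∙ t) ∙ u ⁻¹ ≈ ((u ∙ v) ∙ ι y) ∙ (u ∙ v) ⁻¹
    utu⁻¹ = begin
      (u ∙ t) ∙ u ⁻¹                        ≈⟨ ∙-congʳ (∙-congˡ t≈) ⟩
      (u ∙ ((v ∙ ι y) ∙ v ⁻¹)) ∙ u ⁻¹       ≈⟨ ∙-congʳ (assoc _ _ _) ⟨
      ((u ∙ (v ∙ ι y)) ∙ v ⁻¹) ∙ u ⁻¹       ≈⟨ assoc _ _ _ ⟩
      (u ∙ (v ∙ ι y)) ∙ (v ⁻¹ ∙ u ⁻¹)       ≈⟨ ∙-cong (assoc _ _ _) (⁻¹-anti-homo-∙ u v) ⟨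
      ((u ∙ v) ∙ ι y) ∙ (u ∙ v) ⁻¹          ∎

  -- Reduced words

  reduced : ∀ α → (∀ β → ⟨ β ⟩ ≈ ⟨ α ⟩ → length α ≤ length β) → Reduced α
  reduced α minimal = (α , refl , ≡.refl) , minimal

  Reduced-[] : Reduced []
  Reduced-[] = reduced [] λ _ _ → z≤n

  -- A reflection not passed by α is passed by every word for t ⟨ α ⟩. By exchange such a word is
  -- longer than some word for ⟨ α ⟩, hence longer than α. Comparison of numbers is decidable, which
  -- removes the double negation.
  reflection-lengthens : ∀ α β → IsReflection t → Reduced α → ¬ Odd α t →
                         ⟨ β ⟩ ≈ t ∙ ⟨ α ⟩ → length α < length β
  reflection-lengthens {t} α β ref-t (_ , minimal) ¬odd e =
    decidable-stable (length α <? length β)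
      (¬¬-map shorten (Odd-reflection {β = β} {α} ref-t e ¬odd))
    where
    shorten : Odd β t → length α < length β
    shorten odd with γ , γ≈tβ , γ<β ← Odd⇒shorter β odd =
      ≤-<-trans (minimal γ (trans γ≈tβ (sym (reflection-transpose ref-t e)))) γ<β

  -- For reduced α, `Odd α (ι x)` plays the role of x being a left descent: by this lemma and the
  -- next, it fails exactly when x α is reduced.
  Reduced-∷ : ∀ x α → Reduced α → ¬ Odd α (ι x) → Reduced (x ∷ α)
  Reduced-∷ x α red ¬odd = reduced (x ∷ α) λ β → reflection-lengthens α β (isReflection-ι x) red ¬odd

  Reduced-∷⇒¬Odd : ∀ x α → Reduced (x ∷ α) → ¬ Odd α (ι x)
  Reduced-∷⇒¬Odd x α (_ , minimal) odd with β , e , β<α ← Odd⇒shorter α odd =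
    n≮n _ (<-trans (minimal β e) β<α)

  Reduced-++ˡ : ∀ α β → Reduced (α ++ β) → Reduced α
  Reduced-++ˡ α β (_ , minimal) = reduced α λ γ γ≈α → +-cancelʳ-≤ (length β) (length α) (length γ)
    (≡.subst₂ _≤_ (length-++ α) (length-++ γ)
      (minimal (γ ++ β) (trans (⟨⟩-++ γ β) (trans (∙-congʳ γ≈α) (sym (⟨⟩-++ α β))))))

  Reduced-tail : ∀ x α → Reduced (x ∷ α) → Reduced α
  Reduced-tail x α (_ , minimal) = reduced α λ β β≈α → s≤s⁻¹ (minimal (x ∷ β) (∙-congˡ β≈α))

  -- The reflection α x α⁻¹ takes ⟨ α β ⟩ to ⟨ α x β ⟩, and α β does not pass it.
  Reduced-insert : ∀ x α β → Reduced (α ++ β) → Reduced (α ++ x ∷ []) → Reduced (x ∷ β) →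
                   Reduced (α ++ x ∷ β)
  Reduced-insert x α β red-αβ (_ , minimal) red-xβ = reduced (α ++ x ∷ β) λ γ γ≈ →
    ≡.subst (_≤ length γ) (≡.sym (length-insert α))
      (reflection-lengthens (α ++ β) γ ref-τ red-αβ ¬odd (trans γ≈ αxβ≈ταβ))
    where
    τ = (⟨ α ⟩ ∙ ι x) ∙ ⟨ α ⟩ ⁻¹

    ref-τ : IsReflection τ
    ref-τ = ⟨ α ⟩ , x , refl

    τα≈αx : τ ∙ ⟨ α ⟩ ≈ ⟨ α ⟩ ∙ ι x
    τα≈αx = trans (assoc _ _ _) (trans (∙-congˡ (inverseˡ _)) (identityʳ _))

    αxβ≈ταβ : ⟨ α ++ x ∷ β ⟩ ≈ τ ∙ ⟨ α ++ β ⟩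
    αxβ≈ταβ = begin
      ⟨ α ++ x ∷ β ⟩            ≈⟨ ⟨⟩-++ α (x ∷ β) ⟩
      ⟨ α ⟩ ∙ (ι x ∙ ⟨ β ⟩)     ≈⟨ assoc _ _ _ ⟨
      (⟨ α ⟩ ∙ ι x) ∙ ⟨ β ⟩     ≈⟨ ∙-congʳ τα≈αx ⟨
      (τ ∙ ⟨ α ⟩) ∙ ⟨ β ⟩       ≈⟨ assoc _ _ _ ⟩
      τ ∙ (⟨ α ⟩ ∙ ⟨ β ⟩)       ≈⟨ ∙-congˡ (⟨⟩-++ α β) ⟨
      τ ∙ ⟨ α ++ β ⟩            ∎

    length-insert : ∀ α → length (α ++ x ∷ β) ≡ suc (length (α ++ β))
    length-insert []      = ≡.refl
    length-insert (_ ∷ α) = cong suc (length-insert α)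

    -- If α passed τ, exchange would give a word for ⟨ α ⟩ x shorter than α, although α x is
    -- reduced.
    ¬odd-α : ¬ Odd α τ
    ¬odd-α odd with γ , γ≈τα , γ<α ← Odd⇒shorter α odd =
      n≮n _ (<-≤-trans γ<α (≤-trans (m≤m+n _ _) (subst (_≤ length γ) (length-++ α) (minimal γ γ≈αx))))
      where
      γ≈αx = trans γ≈τα (trans τα≈αx (sym (trans (⟨⟩-++ α _) (∙-congˡ (identityʳ _)))))

    ¬odd : ¬ Odd (α ++ β) τ
    ¬odd odd = ≃⇒¬¬ (Odd-++ α β τ) odd λ
      { (inj₁ (odd-α , _)) → ¬odd-α odd-α
      -- Conjugation by ⟨ α ⟩ turns τ into x, which β does not pass because x β is reduced.
      ; (inj₂ (_ , odd-β)) → ≃⇒¬¬ (Odd-cong β (conjs-unique α τα≈αx)) odd-β (Reduced-∷⇒¬Odd x β red-xβ)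
      }

  -- Were the two equal, x would be a left descent of the element by the reduced word x α, and not
  -- one by the reduced word x β.
  Reduced-∷-incompatible : ∀ x α β → Reduced (x ∷ α) → Reduced (x ∷ β) → ¬ ⟨ x ∷ α ⟩ ≈ ⟨ β ⟩
  Reduced-∷-incompatible x α β (_ , min-α) (_ , min-β) e =
    n≮n _ (<-trans (min-α β (sym e)) (min-β α (ι-transpose e)))

-- Subsets of positions

≤lex-∷ : ∀ {n} b {A B : Subset n} → A ≤lex B → (b ∷ A) ≤lex (b ∷ B)
≤lex-∷ b (inj₁ ≡.refl) = inj₁ ≡.refl
≤lex-∷ b {A} {B} (inj₂ (i , (i∈ , least) , i∈A)) = inj₂ (suc i , (there i∈ , least′ b) , there i∈A)
  where
  least′ : ∀ b j → j ∈ ((b ∷ A) ∪ (b ∷ B)) ─ ((b ∷ A) ∩ (b ∷ B)) → toℕ (suc i) ≤ toℕ j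
  least′ true  (suc j) (there j∈) = s≤s (least j j∈)
  least′ false (suc j) (there j∈) = s≤s (least j j∈)

length-select : ∀ {A : Set a} {n} (ω : Vec A n) I → length (select ω I) ≡ ∣ I ∣
length-select []      []            = ≡.refl
length-select (x ∷ ω) (inside  ∷ I) = cong suc (length-select ω I)
length-select (x ∷ ω) (outside ∷ I) = length-select ω I

removeAt-select : ∀ {A : Set a} {n} (ω : Vec A n) I i → ∃[ J ] removeAt (select ω I) i ≡ select ω J
removeAt-select []      []            ()
removeAt-select (x ∷ ω) (inside  ∷ I) zero    = outside ∷ I , ≡.refl
removeAt-select (x ∷ ω) (inside  ∷ I) (suc i) with J , e ← removeAt-select ω I i = inside ∷ J , cong (x ∷_) e
removeAt-select (x ∷ ω) (outside ∷ I) i       with J , e ← removeAt-select ω I i = outside ∷ J , e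

⊆⇒≡⊎< : ∀ {n} (I J : Subset n) → I ⊆ J → I ≡ J ⊎ ∣ I ∣ < ∣ J ∣
⊆⇒≡⊎< []            []            _   = inj₁ ≡.refl
⊆⇒≡⊎< (inside  ∷ I) (outside ∷ J) I⊆J with () ← I⊆J here
⊆⇒≡⊎< (outside ∷ I) (inside  ∷ J) I⊆J = inj₂ (s≤s (p⊆q⇒∣p∣≤∣q∣ (drop-∷-⊆ I⊆J)))
⊆⇒≡⊎< (inside  ∷ I) (inside  ∷ J) I⊆J with ⊆⇒≡⊎< I J (drop-∷-⊆ I⊆J)
... | inj₁ e  = inj₁ (cong (inside ∷_) e)
... | inj₂ lt = inj₂ (s≤s lt)
⊆⇒≡⊎< (outside ∷ I) (outside ∷ J) I⊆J with ⊆⇒≡⊎< I J (drop-∷-⊆ I⊆J)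
... | inj₁ e  = inj₁ (cong (outside ∷_) e)
... | inj₂ lt = inj₂ lt

trunc : ∀ {n} → ℕ → Subset n → Subset n
trunc zero    I       = ∅
trunc (suc m) []      = []
trunc (suc m) (b ∷ I) = b ∷ trunc m I

trunc-all : ∀ {n m} (I : Subset n) → n ≤ m → trunc m I ≡ I
trunc-all {m = zero}  []      _         = ≡.refl
trunc-all {m = suc m} []      _         = ≡.refl
trunc-all {m = suc m} (b ∷ I) (s≤s n≤m) = cong (b ∷_) (trunc-all I n≤m)

trunc-⊆ : ∀ {n} m (I : Subset n) → trunc m I ⊆ I
trunc-⊆ zero    I       = ⊥⊆
trunc-⊆ (suc m) []      = id
trunc-⊆ (suc m) (b ∷ I) = s⊆s (trunc-⊆ m I)

trunc-suc-⊆ : ∀ {n} m (I : Subset n) → trunc m I ⊆ trunc (suc m) I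
trunc-suc-⊆ zero    I       = ⊥⊆
trunc-suc-⊆ (suc m) []      = id
trunc-suc-⊆ (suc m) (b ∷ I) = s⊆s (trunc-suc-⊆ m I)

∣trunc-suc∣ : ∀ {n} m (I : Subset n) →
              trunc (suc m) I ≡ trunc m I ⊎ ∣ trunc (suc m) I ∣ ≡ suc ∣ trunc m I ∣
∣trunc-suc∣ zero    []            = inj₁ ≡.refl
∣trunc-suc∣ (suc m) []            = inj₁ ≡.refl
∣trunc-suc∣ zero    (inside  ∷ I) = inj₂ ≡.refl
∣trunc-suc∣ zero    (outside ∷ I) = inj₁ ≡.refl
∣trunc-suc∣ (suc m) (b ∷ I) with ∣trunc-suc∣ m I
∣trunc-suc∣ (suc m) (b       ∷ I) | inj₁ e = inj₁ (cong (b ∷_) e)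
∣trunc-suc∣ (suc m) (inside  ∷ I) | inj₂ e = inj₂ (cong suc e)
∣trunc-suc∣ (suc m) (outside ∷ I) | inj₂ e = inj₂ e

select-∅ : ∀ {A : Set a} {n} (ω : Vec A n) → select ω ∅ ≡ []
select-∅ []      = ≡.refl
select-∅ (x ∷ ω) = select-∅ ω

select-trunc : ∀ {A : Set a} {n} (ω : Vec A n) m I → ∃[ β ] select ω (trunc m I) ++ β ≡ select ω I
select-trunc ω       zero    I             = select ω I , cong (_++ select ω I) (select-∅ ω)
select-trunc []      (suc m) []            = [] , ≡.refl
select-trunc (x ∷ ω) (suc m) (inside  ∷ I) with β , e ← select-trunc ω m I = β , cong (x ∷_) e
select-trunc (x ∷ ω) (suc m) (outside ∷ I) = select-trunc ω m I

-- The strict lexicographic relation between I and J, indexed by the first position where they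
-- differ.
data DropsAt : ∀ {n} → Fin n → Subset n → Subset n → Set where
  here  : ∀ {n} {I J : Subset n} → DropsAt zero (inside ∷ I) (outside ∷ J)
  there : ∀ {n i} {I J : Subset n} b → DropsAt i I J → DropsAt (suc i) (b ∷ I) (b ∷ J)

module _ where
  private
    variable
      n : ℕ
      i : Fin n
      I J : Subset n

  dropsAt-trunc : ∀ {m} → toℕ i < m → DropsAt i I J → DropsAt i I (trunc m J)
  dropsAt-trunc (s≤s _)   here        = here
  dropsAt-trunc (s≤s i<m) (there b d) = there b (dropsAt-trunc i<m d)

  dropsAt-∉ : DropsAt i I J → ¬ i ∈ J
  dropsAt-∉ (there b d) (there i∈J) = dropsAt-∉ d i∈J

  ∣insert∣ : DropsAt i I J → ∣ J [ i ]≔ inside ∣ ≡ suc ∣ J ∣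
  ∣insert∣ here              = ≡.refl
  ∣insert∣ (there inside d)  = cong suc (∣insert∣ d)
  ∣insert∣ (there outside d) = ∣insert∣ d

  ⊆-insert : ∀ i (J : Subset n) → J ⊆ J [ i ]≔ inside
  ⊆-insert zero    (b ∷ J) here        = here
  ⊆-insert zero    (b ∷ J) (there j∈J) = there j∈J
  ⊆-insert (suc i) (b ∷ J) = s⊆s (⊆-insert i J)

  ∈-insert : ∀ i (J : Subset n) → i ∈ J [ i ]≔ inside
  ∈-insert zero    (b ∷ J) = here
  ∈-insert (suc i) (b ∷ J) = there (∈-insert i J)

  trunc-⊆-insert : DropsAt i I J → trunc (suc (toℕ i)) I ⊆ J [ i ]≔ inside
  trunc-⊆-insert here        = s⊆s ⊥⊆
  trunc-⊆-insert (there b d) = s⊆s (trunc-⊆-insert d)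

  ∣trunc∣-dropsAt : DropsAt i I J → ∣ trunc (suc (toℕ i)) J ∣ < ∣ trunc (suc (toℕ i)) I ∣
  ∣trunc∣-dropsAt here              = s≤s ≤-refl
  ∣trunc∣-dropsAt (there inside d)  = s≤s (∣trunc∣-dropsAt d)
  ∣trunc∣-dropsAt (there outside d) = ∣trunc∣-dropsAt d

-- Sorted words

module SortedWords {c ℓ s : Level} (𝒲 : CoxeterSystem c ℓ s) where
  open CoxeterSystem 𝒲
  open Coxeter 𝒲
  open Words 𝒲
  open Group W using (refl; sym; trans; ∙-congˡ; ∙-congʳ)
  open GroupProperties W using (∙-cancelˡ)

  -- A local form of lexicographic minimality that passes to suffixes of ω, so that induction on ω
  -- applies. The bit b is left free: a selected x must keep the word reduced, an omitted x must not
  -- be a left descent, and both amount to the same condition.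
  data Greedy : ∀ {n} → Vec S n → Subset n → Set (s ⊔ ℓ) where
    []  : Greedy [] []
    _∷_ : ∀ {n x b} {ω : Vec S n} {I} → Reduced (x ∷ select ω I) → Greedy ω I → Greedy (x ∷ ω) (b ∷ I)

  Greedy⇒Reduced : ∀ {n} (ω : Vec S n) I → Greedy ω I → Reduced (select ω I)
  Greedy⇒Reduced []      []            []      = Reduced-[]
  Greedy⇒Reduced (x ∷ ω) (inside  ∷ I) (r ∷ g) = r
  Greedy⇒Reduced (x ∷ ω) (outside ∷ I) (r ∷ g) = Greedy⇒Reduced ω I g

  -- The element alone decides about the first letter x of ω: it is selected exactly when it is a
  -- left descent.
  Greedy-unique : ∀ {n} (ω : Vec S n) I J → Greedy ω I → Greedy ω J →
                  ⟨ select ω I ⟩ ≈ ⟨ select ω J ⟩ → I ≡ J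
  Greedy-unique []      []            []            _       _       _ = ≡.refl
  Greedy-unique (x ∷ ω) (inside  ∷ I) (inside  ∷ J) (_ ∷ g) (_ ∷ h) e =
    cong (inside ∷_) (Greedy-unique ω I J g h (∙-cancelˡ _ _ _ e))
  Greedy-unique (x ∷ ω) (outside ∷ I) (outside ∷ J) (_ ∷ g) (_ ∷ h) e =
    cong (outside ∷_) (Greedy-unique ω I J g h e)
  Greedy-unique (x ∷ ω) (inside  ∷ I) (outside ∷ J) (q ∷ _) (r ∷ _) e =
    contradiction e (Reduced-∷-incompatible x (select ω I) (select ω J) q r)
  Greedy-unique (x ∷ ω) (outside ∷ I) (inside  ∷ J) (q ∷ _) (r ∷ _) e =
    contradiction (sym e) (Reduced-∷-incompatible x (select ω J) (select ω I) r q)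

  -- The only case against the order is a first difference where J selects x and I omits it; then x
  -- would be a left descent of the element by J, but not by I.
  Greedy-lex : ∀ {n} (ω : Vec S n) I J → Greedy ω I → Reduced (select ω J) →
               ⟨ select ω I ⟩ ≈ ⟨ select ω J ⟩ → I ≤lex J
  Greedy-lex []      []            []            _       _   _ = inj₁ ≡.refl
  Greedy-lex (x ∷ ω) (inside  ∷ I) (inside  ∷ J) (_ ∷ g) red e =
    ≤lex-∷ inside (Greedy-lex ω I J g (Reduced-tail x (select ω J) red) (∙-cancelˡ _ _ _ e))
  Greedy-lex (x ∷ ω) (outside ∷ I) (outside ∷ J) (_ ∷ g) red e =
    ≤lex-∷ outside (Greedy-lex ω I J g red e)
  Greedy-lex (x ∷ ω) (inside  ∷ I) (outside ∷ J) _       _   _ = inj₂ (zero , (here , λ _ _ → z≤n) , here)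
  Greedy-lex (x ∷ ω) (outside ∷ I) (inside  ∷ J) (r ∷ _) red e =
    contradiction (sym e) (Reduced-∷-incompatible x (select ω J) (select ω I) red r)

  module _ {n} (ω : Vec S n) where
    open Sorting ω

    Greedy⇒IsSortIndexSet : ∀ I {u} → Greedy ω I → ⟨ select ω I ⟩ ≈ u → IsSortIndexSet I u
    Greedy⇒IsSortIndexSet I g e =
      (Greedy⇒Reduced ω I g , e) , λ J (red , e′) → Greedy-lex ω I J g red (trans e (sym e′))

  -- The tail is sorted first, to J. If x is not a left descent of ⟨ J ⟩, the bit b stays. Otherwise
  -- exchange yields a shorter subword of the tail for x ⟨ J ⟩, which is sorted again, to K, and b
  -- is flipped. Descents are not decidable, hence the double negation.
  Greedy-exists : ∀ {n} (ω : Vec S n) I → ¬ ¬ (∃[ J ] Greedy ω J × ⟨ select ω J ⟩ ≈ ⟨ select ω I ⟩)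
  Greedy-exists []      []      none = none ([] , [] , refl)
  Greedy-exists (x ∷ ω) (b ∷ I) none = Greedy-exists ω I λ (J , g , J≈I) →
    ¬¬-excluded-middle λ
      { (no ¬odd) → none (b ∷ J , Reduced-∷ x (select ω J) (Greedy⇒Reduced ω J g) ¬odd ∷ g , prepend b J≈I)
      ; (yes odd) → toggle J g J≈I odd
      }
    where
    prepend : ∀ b {J} → ⟨ select ω J ⟩ ≈ ⟨ select ω I ⟩ →
              ⟨ select (x ∷ ω) (b ∷ J) ⟩ ≈ ⟨ select (x ∷ ω) (b ∷ I) ⟩
    prepend inside  e = ∙-congˡ e
    prepend outside e = e

    prepend-not : ∀ b {K} → ⟨ select ω K ⟩ ≈ ι x ∙ ⟨ select ω I ⟩ →
                  ⟨ select (x ∷ ω) (not b ∷ K) ⟩ ≈ ⟨ select (x ∷ ω) (b ∷ I) ⟩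
    prepend-not inside  e = e
    prepend-not outside e = sym (ι-transpose (sym e))

    toggle : ∀ J → Greedy ω J → ⟨ select ω J ⟩ ≈ ⟨ select ω I ⟩ → ¬ Odd (select ω J) (ι x)
    toggle J g J≈I odd
      with i , i≈xJ ← Odd⇒removeAt (select ω J) odd
      with J′ , i≡J′ ← removeAt-select ω J i =
      Greedy-exists ω J′ λ (K , h , K≈J′) →
      let K≈xJ : ⟨ select ω K ⟩ ≈ ι x ∙ ⟨ select ω J ⟩
          K≈xJ = trans K≈J′ (subst (λ α → ⟨ α ⟩ ≈ ι x ∙ ⟨ select ω J ⟩) i≡J′ i≈xJ)

          K≤J′ : length (select ω K) ≤ length (removeAt (select ω J) i)
          K≤J′ = Greedy⇒Reduced ω K h .proj₂ (removeAt (select ω J) i)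
            (subst (λ α → ⟨ α ⟩ ≈ ⟨ select ω K ⟩) (≡.sym i≡J′) (sym K≈J′))

          -- Since x ⟨ K ⟩ = ⟨ J ⟩ and K has fewer letters than the reduced word J, the word x K has
          -- minimal length.
          red : Reduced (x ∷ select ω K)
          red = reduced (x ∷ select ω K) λ β β≈xK → ≤-trans (s≤s K≤J′)
            (≤-trans (≤-reflexive (≡.sym (length-removeAt′ (select ω J) i)))
                     (Greedy⇒Reduced ω J g .proj₂ β (trans β≈xK (sym (ι-transpose (sym K≈xJ))))))
      in none (not b ∷ K , red ∷ h , prepend-not b {K} (trans K≈xJ (∙-congˡ J≈I)))

  -- Truncation replaces each word tested by greediness by a prefix, and prefixes of reduced words
  -- are reduced.
  Greedy-trunc : ∀ {n} (ω : Vec S n) m I → Greedy ω I → Greedy ω (trunc m I)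
  Greedy-trunc []      zero    []      []      = []
  Greedy-trunc []      (suc m) []      []      = []
  Greedy-trunc (x ∷ ω) zero    (b ∷ I) (r ∷ g) =
    subst (λ α → Reduced (x ∷ α)) (≡.sym (select-∅ ω)) (Reduced-++ˡ (x ∷ []) (select ω I) r)
      ∷ Greedy-trunc ω zero I g
  Greedy-trunc (x ∷ ω) (suc m) (b ∷ I) (r ∷ g) with β , e ← select-trunc ω m I =
    Reduced-++ˡ (x ∷ select ω (trunc m I)) β (subst (λ α → Reduced (x ∷ α)) (≡.sym e) r)
      ∷ Greedy-trunc ω m I g

  -- The last component is the greedy condition on J at position i, whose letter y is omitted by J.
  select-dropsAt : ∀ {n i} (ω : Vec S n) {I J : Subset n} → Greedy ω J → DropsAt i I J →
    ∃₂ λ α β → ∃₂ λ y γ →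
      select ω J ≡ α ++ β × select ω I ≡ α ++ y ∷ γ ×
      select ω (J [ i ]≔ inside) ≡ α ++ y ∷ β × Reduced (y ∷ β)
  select-dropsAt (x ∷ ω) (r ∷ _) here = [] , _ , x , _ , ≡.refl , ≡.refl , ≡.refl , r
  select-dropsAt (x ∷ ω) (_ ∷ g) (there inside d)
    with α , β , y , γ , e₁ , e₂ , e₃ , r ← select-dropsAt ω g d =
    x ∷ α , β , y , γ , cong (x ∷_) e₁ , cong (x ∷_) e₂ , cong (x ∷_) e₃ , r
  select-dropsAt (x ∷ ω) (_ ∷ g) (there outside d) = select-dropsAt ω g d

  -- At and after i the conditions are those for J. A letter x before i needs x α y β to be reduced:
  -- greediness of J supplies x α β and y β, that of I supplies x α y as a prefix, and
  -- `Reduced-insert` combines them.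
  Greedy-insert : ∀ {n i} (ω : Vec S n) {I J : Subset n} → Greedy ω I → Greedy ω J → DropsAt i I J →
                  Greedy ω (J [ i ]≔ inside)
  Greedy-insert (x ∷ ω) (q ∷ g) (r ∷ h) here        = r ∷ h
  Greedy-insert (x ∷ ω) (q ∷ g) (r ∷ h) (there b d)
    with α , β , y , γ , J≡ , I≡ , Ji≡ , yβ ← select-dropsAt ω h d =
    subst (λ δ → Reduced (x ∷ δ)) (≡.sym Ji≡)
      (Reduced-insert y (x ∷ α) β (subst (λ δ → Reduced (x ∷ δ)) J≡ r) xαy yβ)
      ∷ Greedy-insert ω g h d
    where
    xαy : Reduced (x ∷ α ++ y ∷ [])
    xαy = Reduced-++ˡ (x ∷ α ++ y ∷ []) γ
      (subst (λ δ → Reduced (x ∷ δ)) (≡.trans I≡ (≡.sym (++-assoc α (y ∷ []) γ))) q)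

  -- Induction along ω. While I and J agree, a common selected letter is cancelled and t is
  -- conjugated by it. If I has the letter at the first difference, the second alternative holds; if
  -- J has it, the remaining parts of I and J coincide.
  reflection⇒⊆⊎DropsAt : ∀ {n t} (ω : Vec S n) I J → Greedy ω I → Greedy ω J → IsReflection t →
    ⟨ select ω J ⟩ ≈ t ∙ ⟨ select ω I ⟩ → length (select ω J) ≡ suc (length (select ω I)) →
    I ⊆ J ⊎ (∃[ i ] DropsAt i I J)
  reflection⇒⊆⊎DropsAt []      []            []            _       _       _     _ _ = inj₁ id
  reflection⇒⊆⊎DropsAt (x ∷ ω) (inside  ∷ I) (outside ∷ J) _       _       _     _ _ = inj₂ (zero , here)
  reflection⇒⊆⊎DropsAt (x ∷ ω) (outside ∷ I) (outside ∷ J) (_ ∷ g) (_ ∷ h) ref-t e l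
    with reflection⇒⊆⊎DropsAt ω I J g h ref-t e l
  ... | inj₁ I⊆J     = inj₁ (s⊆s I⊆J)
  ... | inj₂ (i , d) = inj₂ (suc i , there outside d)
  reflection⇒⊆⊎DropsAt {t = t} (x ∷ ω) (inside ∷ I) (inside ∷ J) (_ ∷ g) (_ ∷ h) ref-t e l
    with reflection⇒⊆⊎DropsAt ω I J g h (isReflection-conj x ref-t) J≈ (suc-injective l)
    where
    J≈ : ⟨ select ω J ⟩ ≈ conj x t ∙ ⟨ select ω I ⟩
    J≈ = ∙-cancelˡ (ι x) _ _ (trans e (sym (conj-shift x t _)))
  ... | inj₁ I⊆J     = inj₁ (s⊆s I⊆J)
  ... | inj₂ (i , d) = inj₂ (suc i , there inside d)
  -- The lifting property: u < xu and xw < w force w = xu for a cover u ≺ w.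
  reflection⇒⊆⊎DropsAt {t = t} (x ∷ ω) (outside ∷ I) (inside ∷ J) (q ∷ g) (r ∷ h) ref-t e l =
    inj₁ (out⊆ (⊆-reflexive I≡J))
    where
    I≈txJ : ⟨ select ω I ⟩ ≈ t ∙ (ι x ∙ ⟨ select ω J ⟩)
    I≈txJ = reflection-transpose ref-t e

    -- Multiplication by t takes x J to the shorter word I, so x J must pass t.
    ¬even : ¬ ¬ Odd (x ∷ select ω J) t
    ¬even ¬odd = n≮n _ (<-trans (≤-reflexive (≡.sym l))
      (reflection-lengthens (x ∷ select ω J) (select ω I) ref-t r ¬odd I≈txJ))

    odd⇒≡ : Odd (x ∷ select ω J) t → I ≡ J
    odd⇒≡ (inj₁ (t≈x , _)) = Greedy-unique ω I J g h (trans I≈txJ (trans (∙-congʳ t≈x) (ι-cancel x _)))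
    -- Exchange would delete a letter of J and leave a word for x ⟨ I ⟩ shorter than J; but x I is
    -- reduced, and I and J have equally many letters.
    odd⇒≡ (inj₂ (_ , odd)) with β , β≈ , β<J ← Odd⇒shorter (select ω J) odd =
      contradiction (<-trans β<J (subst (_≤ length β) (≡.sym l) (q .proj₂ β xβ≈I))) (n≮n _)
      where
      xβ≈I = ι-transpose (trans (trans (∙-congˡ β≈) (conj-shift x t _)) (sym I≈txJ))

    I≡J : I ≡ J
    I≡J = decidable-stable (≡-dec Bool._≟_ I J) (¬¬-map odd⇒≡ ¬even)

-- Bruhat covers added to the sorting order

module Extension {c ℓ s p : Level} (𝒲 : CoxeterSystem c ℓ s) {n : ℕ} (ω : Vec (CoxeterSystem.S 𝒲) n)
  (C : Rel (Coxeter.Sorting.W_ω 𝒲 ω) p)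
  (covers : ∀ u w → C u w → Coxeter.IsBruhatCover 𝒲 (proj₁ u) (proj₁ w)) where
  open CoxeterSystem 𝒲
  open Coxeter 𝒲
  open Sorting ω
  open Words 𝒲
  open SortedWords 𝒲
  open Group W using (refl; sym; trans; reflexive; ∙-congˡ)

  infix 4 _≼_
  _≼_ : Rel W_ω _
  _≼_ = Adding C

  HasLength-resp : ∀ {u w k} → u ≈ w → HasLength u k → HasLength w k
  HasLength-resp u≈w ((α , α≈u , l) , minimal) =
    (α , trans α≈u u≈w , l) , λ β β≈w → minimal β (trans β≈w (sym u≈w))

  HasLength-unique : ∀ {w k l} → HasLength w k → HasLength w l → k ≡ l
  HasLength-unique ((α , α≈w , ≡.refl) , min-k) ((β , β≈w , ≡.refl) , min-l) =
    ≤-antisym (min-k β β≈w) (min-l α α≈w)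

  IsSortIndexSet⇒HasLength : ∀ {I w} → IsSortIndexSet I w → HasLength w ∣ I ∣
  IsSortIndexSet⇒HasLength {I} ((red , e) , _) =
    subst (HasLength _) (length-select ω I) (HasLength-resp e red)

  infix 4 _⋖_
  -- Only lengths are compared; this is not a cover relation. Every step of `_≼_` is an equality or
  -- raises the length, whence antisymmetry. The lengths are carried as witnesses because they
  -- cannot be computed.
  _⋖_ : Rel Carrier _
  u ⋖ w = ∃₂ λ k l → HasLength u k × HasLength w l × k < l

  ⋖-trans : ∀ {u v w} → u ⋖ v → v ⋖ w → u ⋖ w
  ⋖-trans (k , l , hk , hl , k<l) (l′ , m , hl′ , hm , l′<m) =
    k , m , hk , hm , <-trans (<-≤-trans k<l (≤-reflexive (HasLength-unique hl hl′))) l′<m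

  ⋖-respˡ : ∀ {u v w} → u ≈ v → v ⋖ w → u ⋖ w
  ⋖-respˡ u≈v (k , l , hk , hl , k<l) = k , l , HasLength-resp (sym u≈v) hk , hl , k<l

  ⋖-respʳ : ∀ {u v w} → u ⋖ v → v ≈ w → u ⋖ w
  ⋖-respʳ (k , l , hk , hl , k<l) v≈w = k , l , hk , HasLength-resp v≈w hl , k<l

  ⋖-irrefl : ∀ {u w} → u ≈ w → ¬ u ⋖ w
  ⋖-irrefl u≈w (k , l , hk , hl , k<l) = <-irrefl (HasLength-unique (HasLength-resp u≈w hk) hl) k<l

  step⇒≈⊎⋖ : ∀ {u w} → (u ≈ω w ⊎ (u ≤ω w ⊎ C u w)) → u ≈ω w ⊎ proj₁ u ⋖ proj₁ w
  step⇒≈⊎⋖ (inj₁ u≈w) = inj₁ u≈w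
  step⇒≈⊎⋖ (inj₂ (inj₁ (I , J , sI , sJ , I⊆J))) with ⊆⇒≡⊎< I J I⊆J
  ... | inj₁ ≡.refl = inj₁ (trans (sym (sI .proj₁ .proj₂)) (sJ .proj₁ .proj₂))
  ... | inj₂ lt     = inj₂ (∣ I ∣ , ∣ J ∣ , IsSortIndexSet⇒HasLength sI , IsSortIndexSet⇒HasLength sJ , lt)
  step⇒≈⊎⋖ (inj₂ (inj₂ u∼w)) with _ , k , hu , hw ← covers _ _ u∼w = inj₂ (k , suc k , hu , hw , ≤-refl)

  ≼⇒≈⊎⋖ : ∀ {u w} → u ≼ w → u ≈ω w ⊎ proj₁ u ⋖ proj₁ w
  ≼⇒≈⊎⋖ Trans.[ r ] = step⇒≈⊎⋖ r
  ≼⇒≈⊎⋖ (r Trans.∷ rs) with step⇒≈⊎⋖ r | ≼⇒≈⊎⋖ rs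
  ... | inj₁ u≈v | inj₁ v≈w = inj₁ (trans u≈v v≈w)
  ... | inj₁ u≈v | inj₂ v⋖w = inj₂ (⋖-respˡ u≈v v⋖w)
  ... | inj₂ u⋖v | inj₁ v≈w = inj₂ (⋖-respʳ u⋖v v≈w)
  ... | inj₂ u⋖v | inj₂ v⋖w = inj₂ (⋖-trans u⋖v v⋖w)

  ≈⇒≼ : ∀ {u w} → u ≈ω w → u ≼ w
  ≈⇒≼ u≈w = Trans.[ inj₁ u≈w ]

  ≤ω⇒≼ : ∀ {u w} → u ≤ω w → u ≼ w
  ≤ω⇒≼ u≤w = Trans.[ inj₂ (inj₁ u≤w) ]

  ≼-trans : ∀ {u v w} → u ≼ v → v ≼ w → u ≼ w
  ≼-trans = Trans._++_

  ≼-isPartialOrder : IsPartialOrder _≈ω_ _≼_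
  ≼-isPartialOrder = record
    { isPreorder = record
      { isEquivalence = record { refl = refl ; sym = sym ; trans = trans }
      ; reflexive     = ≈⇒≼
      ; trans         = ≼-trans
      }
    ; antisym = antisym
    }
    where
    antisym : ∀ {u w} → u ≼ w → w ≼ u → u ≈ω w
    antisym u≼w w≼u with ≼⇒≈⊎⋖ u≼w | ≼⇒≈⊎⋖ w≼u
    ... | inj₁ u≈w | _        = u≈w
    ... | inj₂ _   | inj₁ w≈u = sym w≈u
    ... | inj₂ u⋖w | inj₂ w⋖u = contradiction (⋖-trans u⋖w w⋖u) (⋖-irrefl refl)

  elem : Subset n → W_ω
  elem I = ⟨ select ω I ⟩ , I , refl

  ⊆⇒≤ω : ∀ u w {I J} → Greedy ω I → ⟨ select ω I ⟩ ≈ proj₁ u → Greedy ω J → ⟨ select ω J ⟩ ≈ proj₁ w →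
         I ⊆ J → u ≤ω w
  ⊆⇒≤ω u w {I} {J} g I≈u h J≈w I⊆J =
    I , J , Greedy⇒IsSortIndexSet ω I g I≈u , Greedy⇒IsSortIndexSet ω J h J≈w , I⊆J

  Greedy⇒HasLength : ∀ {I} → Greedy ω I → HasLength ⟨ select ω I ⟩ ∣ I ∣
  Greedy⇒HasLength {I} g = IsSortIndexSet⇒HasLength (Greedy⇒IsSortIndexSet ω I g refl)

  ≼⇒≡⊎< : ∀ {I J} → Greedy ω I → Greedy ω J → elem I ≼ elem J → I ≡ J ⊎ ∣ I ∣ < ∣ J ∣
  ≼⇒≡⊎< {I} {J} g h I≼J with ≼⇒≈⊎⋖ I≼J
  ... | inj₁ I≈J = inj₁ (Greedy-unique ω I J g h I≈J)
  ... | inj₂ (k , l , hk , hl , k<l) = inj₂ (≡.subst₂ _<_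
    (HasLength-unique hk (Greedy⇒HasLength g)) (HasLength-unique hl (Greedy⇒HasLength h)) k<l)

  module _ (isLattice : ∃₂ λ _∨_ _∧_ → IsLattice _≈ω_ _≼_ _∨_ _∧_) where
    open IsLattice (isLattice .proj₂ .proj₂) using (x≤x∨y; y≤x∨y; ∨-least)

    private
      _∨_ = proj₁ isLattice

    -- The successor in the bounds makes the truncations include position i. Induction on k, the
    -- number of further positions granted to J; for k = 0 the truncation of I has more elements
    -- than that of J.
    ¬trunc≼trunc : ∀ {i I J} → Greedy ω I → Greedy ω J → DropsAt i I J →
      ∀ k → ¬ elem (trunc (suc (toℕ i)) I) ≼ elem (trunc (k + suc (toℕ i)) J)
    ¬trunc≼trunc {i} {I} {J} g h d zero U≼
      with ≼⇒≡⊎< (Greedy-trunc ω (suc (toℕ i)) I g) (Greedy-trunc ω (suc (toℕ i)) J h) U≼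
    ... | inj₁ e  = <-irrefl (cong ∣_∣ (≡.sym e)) (∣trunc∣-dropsAt d)
    ... | inj₂ lt = n≮n _ (<-trans lt (∣trunc∣-dropsAt d))
    ¬trunc≼trunc {i} {I} {J} g h d (suc k) U≼Y′ with ∣trunc-suc∣ (k + suc (toℕ i)) J
    ... | inj₁ e  = ¬trunc≼trunc g h d k (subst (λ Y → elem (trunc (suc (toℕ i)) I) ≼ elem Y) e U≼Y′)
    -- The goal is a negation, so a sorted index set Z of the join may be supposed to exist.
    ... | inj₂ ∣Y′∣ = Greedy-exists ω (proj₁ (proj₂ z)) λ (Z , gZ , Z≈) →
      ¬Z gZ (trans Z≈ (proj₂ (proj₂ z)))
      where
      m = k + suc (toℕ i)
      -- With Jₘ for the part of J before m, Y is Jₘ, Y′ is Jₘ₊₁ and V is Jₘ ∪ {i}.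
      U Y Y′ V : Subset n
      U = trunc (suc (toℕ i)) I
      Y = trunc m J
      Y′ = trunc (suc m) J
      V = Y [ i ]≔ inside
      z = elem U ∨ elem Y

      i<m : toℕ i < m
      i<m = m≤n+m (suc (toℕ i)) k

      dY : DropsAt i I Y
      dY = dropsAt-trunc i<m d

      gU : Greedy ω U
      gU = Greedy-trunc ω (suc (toℕ i)) I g
      gY : Greedy ω Y
      gY = Greedy-trunc ω m J h
      gY′ : Greedy ω Y′
      gY′ = Greedy-trunc ω (suc m) J h
      gV : Greedy ω V
      gV = Greedy-insert ω g gY dY

      ⊆⇒≼ : ∀ {A B} → Greedy ω A → Greedy ω B → A ⊆ B → elem A ≼ elem B
      ⊆⇒≼ {A} {B} a b A⊆B = ≤ω⇒≼ (⊆⇒≤ω (elem A) (elem B) a refl b refl A⊆B)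

      z≼Y′ : z ≼ elem Y′
      z≼Y′ = ∨-least U≼Y′ (⊆⇒≼ gY gY′ (trunc-suc-⊆ m J))

      z≼V : z ≼ elem V
      z≼V = ∨-least (⊆⇒≼ gU gV (trunc-⊆-insert dY)) (⊆⇒≼ gY gV (⊆-insert i Y))

      V≢Y′ : V ≢ Y′
      V≢Y′ e = dropsAt-∉ (dropsAt-trunc (m≤n⇒m≤1+n i<m) d) (subst (i ∈_) e (∈-insert i Y))

      ¬Z : ∀ {Z} → Greedy ω Z → ¬ ⟨ select ω Z ⟩ ≈ proj₁ z
      ¬Z {Z} gZ Z≈z with ≼⇒≡⊎< gY gZ (≼-trans (y≤x∨y (elem U) (elem Y)) (≈⇒≼ (sym Z≈z)))
      ... | inj₁ Y≡Z = ¬trunc≼trunc g h d k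
        (subst (λ Y → elem U ≼ elem Y) (≡.sym Y≡Z) (≼-trans (x≤x∨y (elem U) (elem Y)) (≈⇒≼ (sym Z≈z))))
      -- Y′ and V each have exactly one element more than Y, so Z, larger than Y and below both,
      -- would equal both.
      ... | inj₂ Y<Z
        with ≼⇒≡⊎< gZ gY′ (≼-trans (≈⇒≼ Z≈z) z≼Y′) | ≼⇒≡⊎< gZ gV (≼-trans (≈⇒≼ Z≈z) z≼V)
      ... | inj₁ Z≡Y′ | inj₁ Z≡V = V≢Y′ (≡.trans (≡.sym Z≡V) Z≡Y′)
      ... | inj₂ Z<Y′ | _        = n≮n _ (<-≤-trans Z<Y′ (≤-trans (≤-reflexive ∣Y′∣) Y<Z))
      ... | _         | inj₂ Z<V = n≮n _ (<-≤-trans Z<V (≤-trans (≤-reflexive (∣insert∣ dY)) Y<Z))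

    ¬dropsAt : ∀ u w {i I J} → Greedy ω I → ⟨ select ω I ⟩ ≈ proj₁ u →
               Greedy ω J → ⟨ select ω J ⟩ ≈ proj₁ w →
               u ≼ w → ¬ DropsAt i I J
    -- The choice k = n puts the bound past the end of ω, where the truncation of J is J itself.
    ¬dropsAt u w {i} {I} {J} g I≈u h J≈w u≼w d = ¬trunc≼trunc g h d n
      (≼-trans (≤ω⇒≼ (⊆⇒≤ω (elem (trunc m I)) u (Greedy-trunc ω m I g) refl g I≈u (trunc-⊆ m I)))
        (≼-trans u≼w (≈⇒≼ (trans (sym J≈w) (reflexive (cong (λ J → ⟨ select ω J ⟩) J≡trunc))))))
      where
      m = suc (toℕ i)
      J≡trunc : J ≡ trunc (n + m) J
      J≡trunc = ≡.sym (trunc-all J (m≤m+n n m))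

    -- In a lattice the added relation excludes a drop, which leaves I ⊆ J. The sorted index sets of
    -- u and w exist only up to double negation, and so does the conclusion.
    C⇒¬¬≤ω : ∀ u w → C u w → ¬ ¬ u ≤ω w
    C⇒¬¬≤ω u@(_ , I₀ , I₀≈u) w@(_ , J₀ , J₀≈w) uCw u≰w =
      Greedy-exists ω I₀ λ (I , g , I≈I₀) → Greedy-exists ω J₀ λ (J , h , J≈J₀) →
      compare g (trans I≈I₀ I₀≈u) h (trans J≈J₀ J₀≈w)
      where
      compare : ∀ {I J} → Greedy ω I → ⟨ select ω I ⟩ ≈ proj₁ u →
                Greedy ω J → ⟨ select ω J ⟩ ≈ proj₁ w → Empty.⊥
      compare {I} {J} g I≈u h J≈w
        with (t , ref-t , w≈ut) , k , hu , hw ← covers u w uCw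
        with r , ref-r , w≈ru ← reflectionˡ ref-t w≈ut
        with reflection⇒⊆⊎DropsAt ω I J g h ref-r
               (trans J≈w (trans w≈ru (∙-congˡ (sym I≈u))))
               (≡.trans (HasLength-unique (HasLength-resp J≈w (Greedy⇒Reduced ω J h)) hw)
                 (cong suc (HasLength-unique hu (HasLength-resp I≈u (Greedy⇒Reduced ω I g)))))
      ... | inj₁ I⊆J     = u≰w (⊆⇒≤ω u w g I≈u h J≈w I⊆J)
      ... | inj₂ (_ , d) = ¬dropsAt u w g I≈u h J≈w Trans.[ inj₂ (inj₂ uCw) ] d

mainTheorem9 :
    ∀ {c ℓ s p : Level} (𝒲 : CoxeterSystem c ℓ s) {n} (ω : Vec (CoxeterSystem.S 𝒲) n) →
    let open Coxeter 𝒲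
        open Sorting ω
    in
    (C : Rel W_ω p) →
    (∃₂ λ u w → C u w) →
    (∀ u w → C u w → IsBruhatCover (proj₁ u) (proj₁ w) × ¬ (u ≤ω w)) →
    IsPartialOrder _≈ω_ (Adding C) × ¬ LatticeOrder (Adding C)
mainTheorem9 𝒲 ω C (u , w , uCw) covers =
  ≼-isPartialOrder , λ isLattice → C⇒¬¬≤ω isLattice u w uCw (covers u w uCw .proj₂)
  where open Extension 𝒲 ω C (λ u w uCw → covers u w uCw .proj₁)
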